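{- The evaluation relation $(s,\sigma)\Rightarrow r$ of the basic (delayful) big-step semantics is a setoid predicate: if $(s,\sigma)\Rightarrow r$ and $r\approx r'$ then $(s,\sigma)\Rightarrow r'$. It is total: for every statement $s$ and state $\sigma$ there is a resumption $r$ with $(s,\sigma)\Rightarrow r$. It is deterministic up to bisimilarity: if $(s,\sigma)\Rightarrow r$ and $(s,\sigma)\Rightarrow r'$ then $r\approx r'$.
   Context: Language. Given sets of variables $x$ and pure expressions $e$; values are integers; states $\sigma$ map variables to integers; $\sigma[x\mapsto v]$ is state update; $\llbracket e\rrbracket\sigma\in\mathbb Z$ is the value of $e$ in $\sigma$; $\sigma\models e$ means $\llbracket e\rrbracket\sigma\neq 0$. Statements: $s::=\mathsf{skip}\mid s_0;s_1\mid x:=e\mid\mathsf{if}~e~\mathsf{then}~s_t~\mathsf{else}~s_f\mid\mathsf{while}~e~\mathsf{do}~s_t\mid\mathsf{input}~x\mid\mathsf{output}~e$. Resumptions $r:\mathit{res}$ are defined coinductively by the constructors $\mathit{ret}~\sigma$, $\mathit{in}~f$ ($f:\mathbb Z\to\mathit{res}$), $\mathit{out}~v~r$ ($v\in\mathbb Z$), $\delta~r$. Strong bisimilarity $\approx$ is defined coinductively: $\mathit{ret}~\sigma\approx\mathit{ret}~\sigma$; $\mathit{in}~f\approx\mathit{in}~f_*$ if $\forall v.\,f\,v\approx f_*\,v$; $\mathit{out}~v~r\approx\mathit{out}~v~r_*$ if $r\approx r_*$; $\delta~r\approx\delta~r_*$ if $r\approx r_*$. Convention: strongly bisimilar resumptions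 count as equal (resumptions form a setoid with equality $\approx$), and the rules below are read accordingly. Evaluation $(s,\sigma)\Rightarrow r$ and extended evaluation $(s,r)\stackrel{*}{\Rightarrow}r'$ are defined mutually coinductively by: $(x:=e,\sigma)\Rightarrow\delta(\mathit{ret}~\sigma[x\mapsto\llbracket e\rrbracket\sigma])$; $(\mathsf{skip},\sigma)\Rightarrow\mathit{ret}~\sigma$; $(s_0;s_1,\sigma)\Rightarrow r'$ if $(s_0,\sigma)\Rightarrow r$ and $(s_1,r)\stackrel{*}{\Rightarrow}r'$; $(\mathsf{if}~e~\mathsf{then}~s_t~\mathsf{else}~s_f,\sigma)\Rightarrow r$ if either $\sigma\models e$ and $(s_t,\delta(\mathit{ret}~\sigma))\stackrel{*}{\Rightarrow}r$, or $\sigma\not\models e$ and $(s_f,\delta(\mathit{ret}~\sigma))\stackrel{*}{\Rightarrow}r$; $(\mathsf{while}~e~\mathsf{do}~s_t,\sigma)\Rightarrow r'$ if $\sigma\models e$, $(s_t,\delta(\mathit{ret}~\sigma))\stackrel{*}{\Rightarrow}r$ and $(\mathsf{while}~e~\mathsf{do}~s_t,r)\stackrel{*}{\Rightarrow}r'$; $(\mathsf{while}~e~\mathsf{do}~s_t,\sigma)\Rightarrow\delta(\mathit{ret}~\sigma)$ if $\sigma\not\models e$; $(\mathsf{input}~x,\sigma)\Rightarrow\mathit{in}(\lambda v.\,\mathit{ret}~\sigma[x\mapsto v])$; $(\mathsf{output}~e,\sigma)\Rightarrow\mathit{out}~(\llbracket e\rrbracket\sigma)~(\mathit{ret}~\sigma)$;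 $(s,\mathit{ret}~\sigma)\stackrel{*}{\Rightarrow}r$ if $(s,\sigma)\Rightarrow r$; $(s,\mathit{in}~f)\stackrel{*}{\Rightarrow}\mathit{in}~f'$ if $\forall v.\,(s,f\,v)\stackrel{*}{\Rightarrow}f'\,v$; $(s,\mathit{out}~v~r)\stackrel{*}{\Rightarrow}\mathit{out}~v~r'$ if $(s,r)\stackrel{*}{\Rightarrow}r'$; $(s,\delta~r)\stackrel{*}{\Rightarrow}\delta~r'$ if $(s,r)\stackrel{*}{\Rightarrow}r'$. -}

module Defs where

import Data.Bool as Bool
open import Data.Integer using (ℤ; 0ℤ)
open import Data.List using (List; []; _∷_)
open import Data.Product using (_×_; ∃-syntax)
open import Relation.Binary.Definitions using (DecidableEquality)
open import Relation.Binary.PropositionalEquality using (_≡_; _≢_; refl)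
open import Relation.Nullary using (¬_; does)

module Semantics
  (Var : Set) (_≟_ : DecidableEquality Var)
  (Expr : Set) (⟦_⟧_ : Expr → (Var → ℤ) → ℤ)
  where

  infixl 20 _[_↦_]
  infix  4 _⊨_ _⊭_ _≈_ ⟨_,_⟩⇒_ ⟨_,_⟩*⇒_
  infixr 5 _⨾_
  infix  6 _:=_ if_then_else_ while_loop_

  State : Set
  State = Var → ℤ

  _[_↦_] : State → Var → ℤ → State
  (σ [ x ↦ v ]) y = Bool.if does (y ≟ x) then v else σ y

  _⊨_ _⊭_ : State → Expr → Set
  σ ⊨ e = ⟦ e ⟧ σ ≢ 0ℤ
  σ ⊭ e = ¬ (σ ⊨ e)

  data Stmt : Set where
    skip          : Stmt
    _⨾_           : Stmt → Stmt → Stmt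
    _:=_          : Var → Expr → Stmt
    if_then_else_ : Expr → Stmt → Stmt → Stmt
    while_loop_   : Expr → Stmt → Stmt
    input         : Var → Stmt
    output        : Expr → Stmt

  -- Coinductive types are encoded rather than declared: without --guardedness
  -- Agda accepts no corecursive definitions.
  --
  -- Node is the signature functor of resumptions, and Res its final coalgebra
  -- up to _≈_: a possibly infinite tree, given by the label found at the end of
  -- each path from the root. A path has one entry per step. At an input node
  -- the entry is the integer received; at a δ or out node, which has just one
  -- subtree, force takes that subtree to be the one at entry 0, and labels at
  -- other entries, like those below a ret, are never observed.

  data Node (X : Set) : Set where
    retⁿ : State → Node X
    inⁿ  : (ℤ → X) → Node X
    outⁿ : ℤ → X → Node X
    δⁿ   : X → Node X

  mapⁿ : {X Y : Set} → (X → Y) → Node X → Node Y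
  mapⁿ g (retⁿ σ)   = retⁿ σ
  mapⁿ g (inⁿ f)    = inⁿ (λ v → g (f v))
  mapⁿ g (outⁿ v x) = outⁿ v (g x)
  mapⁿ g (δⁿ x)     = δⁿ (g x)

  data Label : Set where
    retˡ : State → Label
    inˡ  : Label
    outˡ : ℤ → Label
    δˡ   : Label

  record Res : Set where
    constructor tree
    field
      label : List ℤ → Label

  open Res public

  subtree : Res → ℤ → Res
  subtree r v = tree (λ p → label r (v ∷ p))

  force : Res → Node Res
  force r with label r []
  ... | retˡ σ = retⁿ σ
  ... | inˡ    = inⁿ (subtree r)
  ... | outˡ v = outⁿ v (subtree r 0ℤ)
  ... | δˡ     = δⁿ (subtree r 0ℤ)

  ret : State → Res
  ret σ = tree (λ _ → retˡ σ)

  inp : (ℤ → Res) → Res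
  inp f = tree λ where
    []      → inˡ
    (v ∷ p) → label (f v) p

  out : ℤ → Res → Res
  out v r = tree λ where
    []      → outˡ v
    (_ ∷ p) → label r p

  δ : Res → Res
  δ r = tree λ where
    []      → δˡ
    (_ ∷ p) → label r p

  force-ret : ∀ σ → force (ret σ) ≡ retⁿ σ
  force-ret σ = refl

  force-inp : ∀ f → force (inp f) ≡ inⁿ f
  force-inp f = refl

  force-out : ∀ v r → force (out v r) ≡ outⁿ v r
  force-out v r = refl

  force-δ : ∀ r → force (δ r) ≡ δⁿ r
  force-δ r = refl

  -- Corecursion into Res.

  module _ {X : Set} (c : X → Node X) where

    labelAt : Node X → List ℤ → Label
    labelAt (retⁿ σ)   _       = retˡ σ
    labelAt (inⁿ f)    []      = inˡ
    labelAt (inⁿ f)    (v ∷ p) = labelAt (c (f v)) p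
    labelAt (outⁿ v x) []      = outˡ v
    labelAt (outⁿ v x) (_ ∷ p) = labelAt (c x) p
    labelAt (δⁿ x)     []      = δˡ
    labelAt (δⁿ x)     (_ ∷ p) = labelAt (c x) p

    unfold : X → Res
    unfold x = tree (labelAt (c x))

    force-unfold : ∀ x → force (unfold x) ≡ mapⁿ unfold (c x)
    force-unfold x with c x
    ... | retⁿ σ   = refl
    ... | inⁿ f    = refl
    ... | outⁿ v y = refl
    ... | δⁿ y     = refl

  -- A coinductively defined relation is the union of all relations R each of
  -- whose instances is the conclusion of a rule with premises in R.

  data Bisim (R : Res → Res → Set) : Node Res → Node Res → Set where
    ret≈ : ∀ {σ} → Bisim R (retⁿ σ) (retⁿ σ)
    in≈  : ∀ {f f*} → (∀ v → R (f v) (f* v)) → Bisim R (inⁿ f) (inⁿ f*)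
    out≈ : ∀ {v r r*} → R r r* → Bisim R (outⁿ v r) (outⁿ v r*)
    δ≈   : ∀ {r r*} → R r r* → Bisim R (δⁿ r) (δⁿ r*)

  IsBisimulation : (Res → Res → Set) → Set
  IsBisimulation R = ∀ {r r*} → R r r* → Bisim R (force r) (force r*)

  _≈_ : Res → Res → Set₁
  r ≈ r* = ∃[ R ] IsBisimulation R × R r r*

  -- The rules of evaluation and extended evaluation, with premises in E and E*.
  -- Bisimilar resumptions count as equal, so wherever the conclusion of a rule
  -- has a resumption built with a constructor, the rule admits any resumption
  -- bisimilar to it.

  data EvalRule (E  : Stmt → State → Res → Set₁)
                (E* : Stmt → Res → Res → Set₁) :
                Stmt → State → Res → Set₁ where

    assign : ∀ {x e σ r} →
      r ≈ δ (ret (σ [ x ↦ ⟦ e ⟧ σ ])) →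
      EvalRule E E* (x := e) σ r

    skip : ∀ {σ r} →
      r ≈ ret σ →
      EvalRule E E* skip σ r

    seq : ∀ {s₀ s₁ σ r r′} →
      E s₀ σ r → E* s₁ r r′ →
      EvalRule E E* (s₀ ⨾ s₁) σ r′

    if-true : ∀ {e sₜ s_f σ r} →
      σ ⊨ e → E* sₜ (δ (ret σ)) r →
      EvalRule E E* (if e then sₜ else s_f) σ r

    if-false : ∀ {e sₜ s_f σ r} →
      σ ⊭ e → E* s_f (δ (ret σ)) r →
      EvalRule E E* (if e then sₜ else s_f) σ r

    while-true : ∀ {e sₜ σ r r′} →
      σ ⊨ e → E* sₜ (δ (ret σ)) r → E* (while e loop sₜ) r r′ →
      EvalRule E E* (while e loop sₜ) σ r′

    while-false : ∀ {e sₜ σ r} →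
      σ ⊭ e → r ≈ δ (ret σ) →
      EvalRule E E* (while e loop sₜ) σ r

    input : ∀ {x σ r} →
      r ≈ inp (λ v → ret (σ [ x ↦ v ])) →
      EvalRule E E* (input x) σ r

    output : ∀ {e σ r} →
      r ≈ out (⟦ e ⟧ σ) (ret σ) →
      EvalRule E E* (output e) σ r

  data EvalRule* (E  : Stmt → State → Res → Set₁)
                 (E* : Stmt → Res → Res → Set₁) :
                 Stmt → Res → Res → Set₁ where

    ret* : ∀ {s σ q r} →
      q ≈ ret σ →
      E s σ r →
      EvalRule* E E* s q r

    in* : ∀ {s f f′ q q′} →
      q ≈ inp f → q′ ≈ inp f′ →
      (∀ v → E* s (f v) (f′ v)) →
      EvalRule* E E* s q q′

    out* : ∀ {s v r r′ q q′} →
      q ≈ out v r → q′ ≈ out v r′ →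
      E* s r r′ →
      EvalRule* E E* s q q′

    δ* : ∀ {s r r′ q q′} →
      q ≈ δ r → q′ ≈ δ r′ →
      E* s r r′ →
      EvalRule* E E* s q q′

  record IsEvaluation (E  : Stmt → State → Res → Set₁)
                      (E* : Stmt → Res → Res → Set₁) : Set₁ where
    field
      eval  : ∀ {s σ r} → E s σ r → EvalRule E E* s σ r
      eval* : ∀ {s r r′} → E* s r r′ → EvalRule* E E* s r r′

  ⟨_,_⟩⇒_ : Stmt → State → Res → Set₂
  ⟨ s , σ ⟩⇒ r = ∃[ E ] ∃[ E* ] IsEvaluation E E* × E s σ r

  ⟨_,_⟩*⇒_ : Stmt → Res → Res → Set₂
  ⟨ s , r ⟩*⇒ r′ = ∃[ E ] ∃[ E* ] IsEvaluation E E* × E* s r r′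

{-# OPTIONS --safe #-}

-- Two resumptions are bisimilar exactly when their labels agree on all
-- observable paths, so bisimilarity has a small description _∼_ which can be
-- proved path by path. A total function exec satisfies the evaluation rules,
-- which gives totality. Conversely every evaluation agrees with exec, by
-- structural induction on the statement and, inside it, induction on the path:
-- an iteration of a loop starts with a δ, so it consumes an entry of the path.
-- Determinism follows by transitivity.

module Submission where

import Data.Bool as Bool
open import Data.Empty using (⊥-elim)
open import Data.Integer as ℤ using (ℤ; 0ℤ)
open import Data.List using (List; []; _∷_)
open import Data.Product using (_×_; _,_; ∃-syntax)
open import Data.Sum using (_⊎_; inj₁; inj₂)
open import Data.Unit using (⊤)
open import Level using (Lift)
open import Relation.Binary.Definitions using (DecidableEquality)
open import Relation.Binary.PropositionalEquality
  using (_≡_; refl; sym; trans; cong)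
open import Relation.Nullary using (¬_; Dec; does; yes; no)
open import Relation.Nullary.Decidable using (¬?; dec-true; dec-false)
open import Defs

module _
  (Var : Set) (_≟_ : DecidableEquality Var)
  (Expr : Set) (⟦_⟧_ : Expr → (Var → ℤ) → ℤ)
  where

  open Semantics Var _≟_ Expr ⟦_⟧_

  -- Bisimilarity as equality of observable labels.

  infix 4 _∼_

  -- Reading through `force` replaces the entry at a `δ` or `out` node by `0ℤ` and freezes the label
  -- below a `ret`, so unobservable labels of `r` have no effect.
  observe : Res → List ℤ → Label
  observe r = labelAt force (force r)

  -- Being in `Set`, this relation can itself serve as the witness `R` in `_≈_`, which lies in
  -- `Set₁`.
  record _∼_ (r r* : Res) : Set where
    constructor pointwise
    field
      at : ∀ p → observe r p ≡ observe r* p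

  open _∼_

  ∼-refl : ∀ {r} → r ∼ r
  ∼-refl = pointwise λ p → refl

  ∼-sym : ∀ {r r*} → r ∼ r* → r* ∼ r
  ∼-sym e = pointwise λ p → sym (at e p)

  ∼-trans : ∀ {r₁ r₂ r₃} → r₁ ∼ r₂ → r₂ ∼ r₃ → r₁ ∼ r₃
  ∼-trans e e′ = pointwise λ p → trans (at e p) (at e′ p)

  -- The empty path forces both nodes to have the same constructor and data; the longer paths
  -- compare the subtrees.
  Bisim-∼ : ∀ {n n*} → (∀ p → labelAt force n p ≡ labelAt force n* p) → Bisim _∼_ n n*
  Bisim-∼ {retⁿ σ} {retⁿ τ} e with refl ← e [] = ret≈
  Bisim-∼ {retⁿ σ} {inⁿ f} e with () ← e []
  Bisim-∼ {retⁿ σ} {outⁿ v r} e with () ← e []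
  Bisim-∼ {retⁿ σ} {δⁿ r} e with () ← e []
  Bisim-∼ {inⁿ f} {retⁿ σ} e with () ← e []
  Bisim-∼ {inⁿ f} {inⁿ g} e = in≈ λ v → pointwise λ p → e (v ∷ p)
  Bisim-∼ {inⁿ f} {outⁿ v r} e with () ← e []
  Bisim-∼ {inⁿ f} {δⁿ r} e with () ← e []
  Bisim-∼ {outⁿ v r} {retⁿ σ} e with () ← e []
  Bisim-∼ {outⁿ v r} {inⁿ f} e with () ← e []
  -- The entry `0ℤ` is arbitrary: `labelAt` ignores it at a node with one subtree.
  Bisim-∼ {outⁿ v r} {outⁿ w r*} e with refl ← e [] = out≈ (pointwise λ p → e (0ℤ ∷ p))
  Bisim-∼ {outⁿ v r} {δⁿ r*} e with () ← e []
  Bisim-∼ {δⁿ r} {retⁿ σ} e with () ← e []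
  Bisim-∼ {δⁿ r} {inⁿ f} e with () ← e []
  Bisim-∼ {δⁿ r} {outⁿ v r*} e with () ← e []
  Bisim-∼ {δⁿ r} {δⁿ r*} e = δ≈ (pointwise λ p → e (0ℤ ∷ p))

  -- Each entry of the path uses up one unfolding of the bisimulation.
  Bisim⇒labelAt : ∀ {R} → IsBisimulation R → ∀ {n n*} → Bisim R n n* →
                  ∀ p → labelAt force n p ≡ labelAt force n* p
  Bisim⇒labelAt b ret≈ p = refl
  Bisim⇒labelAt b (in≈ e) [] = refl
  Bisim⇒labelAt b (in≈ e) (v ∷ p) = Bisim⇒labelAt b (b (e v)) p
  Bisim⇒labelAt b (out≈ e) [] = refl
  Bisim⇒labelAt b (out≈ e) (v ∷ p) = Bisim⇒labelAt b (b e) p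
  Bisim⇒labelAt b (δ≈ e) [] = refl
  Bisim⇒labelAt b (δ≈ e) (v ∷ p) = Bisim⇒labelAt b (b e) p

  ∼-IsBisimulation : IsBisimulation _∼_
  ∼-IsBisimulation e = Bisim-∼ (at e)

  ≈⇒∼ : ∀ {r r*} → r ≈ r* → r ∼ r*
  ≈⇒∼ (R , b , e) = pointwise (Bisim⇒labelAt b (b e))

  ∼⇒≈ : ∀ {r r*} → r ∼ r* → r ≈ r*
  ∼⇒≈ e = _∼_ , ∼-IsBisimulation , e

  ≈-refl : ∀ {r} → r ≈ r
  ≈-refl = ∼⇒≈ ∼-refl

  ≈-sym : ∀ {r r*} → r ≈ r* → r* ≈ r
  ≈-sym e = ∼⇒≈ (∼-sym (≈⇒∼ e))

  ≈-trans : ∀ {r₁ r₂ r₃} → r₁ ≈ r₂ → r₂ ≈ r₃ → r₁ ≈ r₃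
  ≈-trans e e′ = ∼⇒≈ (∼-trans (≈⇒∼ e) (≈⇒∼ e′))

  -- Observing constructors and corecursive resumptions.

  unforce : Node Res → Res
  unforce (retⁿ σ)   = ret σ
  unforce (inⁿ f)    = inp f
  unforce (outⁿ v r) = out v r
  unforce (δⁿ r)     = δ r

  observe-unforce : ∀ n p → observe (unforce n) p ≡ labelAt force n p
  observe-unforce (retⁿ σ)   p = refl
  observe-unforce (inⁿ f)    p = refl
  observe-unforce (outⁿ v r) p = refl
  observe-unforce (δⁿ r)     p = refl

  labelAt-mapⁿ-unfold : {X : Set} (c : X → Node X) (n : Node X) (p : List ℤ) →
                        labelAt force (mapⁿ (unfold c) n) p ≡ labelAt c n p
  observe-unfold : {X : Set} (c : X → Node X) (x : X) (p : List ℤ) →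
                   observe (unfold c x) p ≡ labelAt c (c x) p

  labelAt-mapⁿ-unfold c (retⁿ σ)   p       = refl
  labelAt-mapⁿ-unfold c (inⁿ f)    []      = refl
  labelAt-mapⁿ-unfold c (inⁿ f)    (v ∷ p) = observe-unfold c (f v) p
  labelAt-mapⁿ-unfold c (outⁿ v x) []      = refl
  labelAt-mapⁿ-unfold c (outⁿ v x) (_ ∷ p) = observe-unfold c x p
  labelAt-mapⁿ-unfold c (δⁿ x)     []      = refl
  labelAt-mapⁿ-unfold c (δⁿ x)     (_ ∷ p) = observe-unfold c x p

  observe-unfold c x p =
    trans (cong (λ n → labelAt force n p) (force-unfold c x))
      (labelAt-mapⁿ-unfold c (c x) p)

  unfold-∼ : {X : Set} (c : X → Node X) (x : X) {r : Res} →
             (∀ p → labelAt c (c x) p ≡ observe r p) → unfold c x ∼ r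
  unfold-∼ c x e = pointwise λ p → trans (observe-unfold c x p) (e p)

  -- Continuing a resumption at its returns.

  -- In the state space Res ⊎ Res, inj₁ q stands for q with a return σ still to
  -- be continued by g σ, and inj₂ r for r itself. A loop is a g whose nodes have
  -- inj₁ in them.

  splice : (State → Node (Res ⊎ Res)) → Node Res → Node (Res ⊎ Res)
  splice g (retⁿ σ)   = g σ
  splice g (inⁿ f)    = inⁿ λ v → inj₁ (f v)
  splice g (outⁿ v r) = outⁿ v (inj₁ r)
  splice g (δⁿ r)     = δⁿ (inj₁ r)

  runⁿ : (State → Node (Res ⊎ Res)) → Res ⊎ Res → Node (Res ⊎ Res)
  runⁿ g (inj₁ q) = splice g (force q)
  runⁿ g (inj₂ r) = mapⁿ inj₂ (force r)

  run : (State → Node (Res ⊎ Res)) → Res → Res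
  run g q = unfold (runⁿ g) (inj₁ q)

  -- A run in `inj₂` never goes back to `inj₁`, so it copies the resumption.
  labelAt-inj₂ : ∀ g n p → labelAt (runⁿ g) (mapⁿ inj₂ n) p ≡ labelAt force n p
  labelAt-inj₂ g (retⁿ σ)   p       = refl
  labelAt-inj₂ g (inⁿ f)    []      = refl
  labelAt-inj₂ g (inⁿ f)    (v ∷ p) = labelAt-inj₂ g (force (f v)) p
  labelAt-inj₂ g (outⁿ v r) []      = refl
  labelAt-inj₂ g (outⁿ v r) (_ ∷ p) = labelAt-inj₂ g (force r) p
  labelAt-inj₂ g (δⁿ r)     []      = refl
  labelAt-inj₂ g (δⁿ r)     (_ ∷ p) = labelAt-inj₂ g (force r) p

  splice-cong : ∀ g {n n*} → Bisim _∼_ n n* → ∀ p →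
                labelAt (runⁿ g) (splice g n) p ≡ labelAt (runⁿ g) (splice g n*) p
  splice-cong g ret≈     p       = refl
  splice-cong g (in≈ e)  []      = refl
  splice-cong g (in≈ e)  (v ∷ p) = splice-cong g (∼-IsBisimulation (e v)) p
  splice-cong g (out≈ e) []      = refl
  splice-cong g (out≈ e) (_ ∷ p) = splice-cong g (∼-IsBisimulation e) p
  splice-cong g (δ≈ e)   []      = refl
  splice-cong g (δ≈ e)   (_ ∷ p) = splice-cong g (∼-IsBisimulation e) p

  run-cong : ∀ g {q q*} → q ∼ q* → run g q ∼ run g q*
  run-cong g {q} {q*} e = unfold-∼ (runⁿ g) (inj₁ q) λ p →
    trans (splice-cong g (∼-IsBisimulation e) p)
      (sym (observe-unfold (runⁿ g) (inj₁ q*) p))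

  -- A functional interpreter.

  _⊨?_ : ∀ σ e → Dec (σ ⊨ e)
  σ ⊨? e = ¬? (⟦ e ⟧ σ ℤ.≟ 0ℤ)

  choose : {A : Set} → Expr → State → A → A → A
  choose e σ a b = Bool.if does (σ ⊨? e) then a else b

  choose-true : {A : Set} (e : Expr) (σ : State) {a b : A} → σ ⊨ e → choose e σ a b ≡ a
  choose-true e σ {a} {b} t = cong (Bool.if_then a else b) (dec-true (σ ⊨? e) t)

  choose-false : {A : Set} (e : Expr) (σ : State) {a b : A} → σ ⊭ e → choose e σ a b ≡ b
  choose-false e σ {a} {b} f = cong (Bool.if_then a else b) (dec-false (σ ⊨? e) f)

  -- Recursion is on the statement alone: iterating is left to `run`. A loop emits its `δ` at once
  -- and keeps the run of its body in `inj₁`, so that each return of the body meets `step` of the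
  -- loop again.
  step : Stmt → State → Node (Res ⊎ Res)
  step skip                     σ = retⁿ σ
  step (s₀ ⨾ s₁)                σ =
    mapⁿ inj₂ (force (run (step s₁) (run (step s₀) (ret σ))))
  step (x := e)                 σ = δⁿ (inj₂ (ret (σ [ x ↦ ⟦ e ⟧ σ ])))
  step (if e then sₜ else s_f)  σ =
    δⁿ (inj₂ (choose e σ (run (step sₜ) (ret σ)) (run (step s_f) (ret σ))))
  step (while e loop sₜ)        σ =
    δⁿ (choose e σ (inj₁ (run (step sₜ) (ret σ))) (inj₂ (ret σ)))
  step (input x)                σ = inⁿ λ v → inj₂ (ret (σ [ x ↦ v ]))
  step (output e)               σ = outⁿ (⟦ e ⟧ σ) (inj₂ (ret σ))

  exec* : Stmt → Res → Res
  exec* s = run (step s)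

  exec : Stmt → State → Res
  exec s σ = exec* s (ret σ)

  -- Equations for the interpreter, one per rule.

  exec-step : ∀ s σ n → step s σ ≡ mapⁿ inj₂ n → exec s σ ∼ unforce n
  exec-step s σ n eq = unfold-∼ (runⁿ (step s)) (inj₁ (ret σ)) λ p →
    trans (cong (λ m → labelAt (runⁿ (step s)) m p) eq)
      (trans (labelAt-inj₂ (step s) n p) (sym (observe-unforce n p)))

  ∼-unforce-force : ∀ r → unforce (force r) ∼ r
  ∼-unforce-force r = pointwise (observe-unforce (force r))

  exec*-inp : ∀ s f → exec* s (inp f) ∼ inp (λ v → exec* s (f v))
  exec*-inp s f = pointwise λ where
    []      → refl
    (_ ∷ p) → refl

  exec*-out : ∀ s v r → exec* s (out v r) ∼ out v (exec* s r)
  exec*-out s v r = pointwise λ where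
    []      → refl
    (_ ∷ p) → refl

  exec*-δ : ∀ s r → exec* s (δ r) ∼ δ (exec* s r)
  exec*-δ s r = pointwise λ where
    []      → refl
    (_ ∷ p) → refl

  exec-seq : ∀ s₀ s₁ σ → exec (s₀ ⨾ s₁) σ ∼ exec* s₁ (exec s₀ σ)
  exec-seq s₀ s₁ σ = ∼-trans (exec-step (s₀ ⨾ s₁) σ (force r) refl) (∼-unforce-force r)
    where r = exec* s₁ (exec s₀ σ)

  exec-skip : ∀ σ → exec skip σ ∼ ret σ
  exec-skip σ = exec-step skip σ (retⁿ σ) refl

  exec-assign : ∀ x e σ → exec (x := e) σ ∼ δ (ret (σ [ x ↦ ⟦ e ⟧ σ ]))
  exec-assign x e σ = exec-step (x := e) σ (δⁿ (ret (σ [ x ↦ ⟦ e ⟧ σ ]))) refl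

  exec-input : ∀ x σ → exec (input x) σ ∼ inp (λ v → ret (σ [ x ↦ v ]))
  exec-input x σ = exec-step (input x) σ (inⁿ λ v → ret (σ [ x ↦ v ])) refl

  exec-output : ∀ e σ → exec (output e) σ ∼ out (⟦ e ⟧ σ) (ret σ)
  exec-output e σ = exec-step (output e) σ (outⁿ (⟦ e ⟧ σ) (ret σ)) refl

  exec-if-true : ∀ e sₜ s_f σ → σ ⊨ e →
                 exec (if e then sₜ else s_f) σ ∼ exec* sₜ (δ (ret σ))
  exec-if-true e sₜ s_f σ t =
    ∼-trans (exec-step (if e then sₜ else s_f) σ (δⁿ (exec sₜ σ))
      (cong (λ r → δⁿ (inj₂ r)) (choose-true e σ t)))
      (∼-sym (exec*-δ sₜ (ret σ)))

  exec-if-false : ∀ e sₜ s_f σ → σ ⊭ e →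
                  exec (if e then sₜ else s_f) σ ∼ exec* s_f (δ (ret σ))
  exec-if-false e sₜ s_f σ f =
    ∼-trans (exec-step (if e then sₜ else s_f) σ (δⁿ (exec s_f σ))
      (cong (λ r → δⁿ (inj₂ r)) (choose-false e σ f)))
      (∼-sym (exec*-δ s_f (ret σ)))

  -- The `δ` emitted at the loop head is the one in front of the body's run: `runⁿ` takes
  -- `inj₁ (δ (exec sₜ σ))` to exactly the node that `step` gives.
  exec-while-true : ∀ e sₜ σ → σ ⊨ e →
    exec (while e loop sₜ) σ ∼ exec* (while e loop sₜ) (exec* sₜ (δ (ret σ)))
  exec-while-true e sₜ σ t =
    ∼-trans
      (unfold-∼ (runⁿ (step w)) (inj₁ (ret σ)) λ p →
        trans (cong (λ x → labelAt (runⁿ (step w)) (δⁿ x) p) (choose-true e σ t))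
          (sym (observe-unfold (runⁿ (step w)) (inj₁ (δ (exec sₜ σ))) p)))
      (run-cong (step w) (∼-sym (exec*-δ sₜ (ret σ))))
    where w = while e loop sₜ

  exec-while-false : ∀ e sₜ σ → σ ⊭ e → exec (while e loop sₜ) σ ∼ δ (ret σ)
  exec-while-false e sₜ σ f =
    exec-step (while e loop sₜ) σ (δⁿ (ret σ)) (cong δⁿ (choose-false e σ f))

  -- Totality: the graph of the interpreter obeys the rules.

  exec-IsEvaluation : IsEvaluation (λ s σ r → r ≈ exec s σ) (λ s q r → r ≈ exec* s q)
  exec-IsEvaluation = record
    { eval  = eval
    ; eval* = λ {s} {q} → eval* s (force q) (∼-sym (∼-unforce-force q))
    }
    where
    E  = λ s σ r → r ≈ exec s σ
    E* = λ s q r → r ≈ exec* s q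

    _then∼_ : ∀ {r₁ r₂ r₃} → r₁ ≈ r₂ → r₂ ∼ r₃ → r₁ ≈ r₃
    e then∼ e′ = ≈-trans e (∼⇒≈ e′)

    eval : ∀ {s σ r} → r ≈ exec s σ → EvalRule E E* s σ r
    eval {skip} {σ} b = skip (b then∼ exec-skip σ)
    eval {s₀ ⨾ s₁} {σ} b = seq ≈-refl (b then∼ exec-seq s₀ s₁ σ)
    eval {x := e} {σ} b = assign (b then∼ exec-assign x e σ)
    eval {if e then sₜ else s_f} {σ} b with σ ⊨? e
    ... | yes t = if-true t (b then∼ exec-if-true e sₜ s_f σ t)
    ... | no f  = if-false f (b then∼ exec-if-false e sₜ s_f σ f)
    eval {while e loop sₜ} {σ} b with σ ⊨? e
    ... | yes t = while-true t ≈-refl (b then∼ exec-while-true e sₜ σ t)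
    ... | no f  = while-false f (b then∼ exec-while-false e sₜ σ f)
    eval {input x} {σ} b = input (b then∼ exec-input x σ)
    eval {output e} {σ} b = output (b then∼ exec-output e σ)

    -- Matching on `n` instead of `q` reveals which constructor `q` is built with up to `_∼_`.
    eval* : ∀ s n {q r} → q ∼ unforce n → r ≈ exec* s q → EvalRule* E E* s q r
    eval* s (retⁿ σ) e b = ret* (∼⇒≈ e) (b then∼ run-cong (step s) e)
    eval* s (inⁿ f) e b =
      in* (∼⇒≈ e) (b then∼ ∼-trans (run-cong (step s) e) (exec*-inp s f)) λ v → ≈-refl
    eval* s (outⁿ v r) e b =
      out* (∼⇒≈ e) (b then∼ ∼-trans (run-cong (step s) e) (exec*-out s v r)) ≈-refl
    eval* s (δⁿ r) e b =
      δ* (∼⇒≈ e) (b then∼ ∼-trans (run-cong (step s) e) (exec*-δ s r)) ≈-refl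

  -- Closure of an evaluation under bisimilarity.

  module Saturation
    {E : Stmt → State → Res → Set₁} {E* : Stmt → Res → Res → Set₁}
    (isEval : IsEvaluation E E*)
    where

    open IsEvaluation isEval

    -- Closing in the result is enough: each rule either states its result up to `_≈_` or hands on
    -- the result of its last premise, and intermediate resumptions stay as they are.
    E≈ : Stmt → State → Res → Set₁
    E≈ s σ r = ∃[ r₀ ] E s σ r₀ × r ≈ r₀

    E*≈ : Stmt → Res → Res → Set₁
    E*≈ s q r = ∃[ r₀ ] E* s q r₀ × r ≈ r₀

    evalRule : ∀ {s σ r₀ r} → EvalRule E E* s σ r₀ → r ≈ r₀ → EvalRule E≈ E*≈ s σ r
    evalRule (assign b)         e = assign (≈-trans e b)
    evalRule (skip b)           e = skip (≈-trans e b)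
    evalRule (seq x y)          e = seq (_ , x , ≈-refl) (_ , y , e)
    evalRule (if-true t x)      e = if-true t (_ , x , e)
    evalRule (if-false f x)     e = if-false f (_ , x , e)
    evalRule (while-true t x y) e = while-true t (_ , x , ≈-refl) (_ , y , e)
    evalRule (while-false f b)  e = while-false f (≈-trans e b)
    evalRule (input b)          e = input (≈-trans e b)
    evalRule (output b)         e = output (≈-trans e b)

    evalRule* : ∀ {s q r₀ r} → EvalRule* E E* s q r₀ → r ≈ r₀ → EvalRule* E≈ E*≈ s q r
    evalRule* (ret* a x)   e = ret* a (_ , x , e)
    evalRule* (in* a b x)  e = in* a (≈-trans e b) λ v → _ , x v , ≈-refl
    evalRule* (out* a b x) e = out* a (≈-trans e b) (_ , x , ≈-refl)
    evalRule* (δ* a b x)   e = δ* a (≈-trans e b) (_ , x , ≈-refl)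

    saturated : IsEvaluation E≈ E*≈
    saturated = record
      { eval  = λ (_ , x , e) → evalRule (eval x) e
      ; eval* = λ (_ , x , e) → evalRule* (eval* x) e
      }

  -- Agreement of every evaluation with the interpreter.

  module Uniqueness
    {E : Stmt → State → Res → Set₁} {E* : Stmt → Res → Res → Set₁}
    (isEval : IsEvaluation E E*)
    where

    open IsEvaluation isEval

    UniqueAt : Stmt → List ℤ → Set₁
    UniqueAt s p = ∀ {σ r} → E s σ r → observe r p ≡ observe (exec s σ) p

    UniqueAt* : Stmt → List ℤ → Set₁
    UniqueAt* s p = ∀ {q r} → E* s q r → observe r p ≡ observe (exec* s q) p

    UniqueBelow* : Stmt → List ℤ → Set₁
    UniqueBelow* s []      = Lift _ ⊤
    UniqueBelow* s (_ ∷ p) = UniqueAt* s p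

    uniqueAt*-induction : ∀ s → (∀ p → UniqueBelow* s p → UniqueAt* s p) →
                          ∀ p → UniqueAt* s p
    uniqueAt*-induction s h []      = h [] _
    uniqueAt*-induction s h (v ∷ p) = h (v ∷ p) (uniqueAt*-induction s h p)

    -- Away from `ret*`, the rule fixes the root label and `below` covers the subtrees. The first
    -- hypothesis is restricted to `q ∼ ret σ` so that it holds vacuously when `q` starts with a
    -- `δ`.
    uniqueAt*-step : ∀ s p {q r} →
      (∀ {σ} → q ∼ ret σ → E s σ r → observe r p ≡ observe (exec s σ) p) →
      UniqueBelow* s p → E* s q r → observe r p ≡ observe (exec* s q) p
    uniqueAt*-step s p {q} {r} h below x = go p h below (eval* x)
      where
      through : ∀ {p q₀ r₀} → q ≈ q₀ → r ≈ r₀ →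
                observe r₀ p ≡ observe (exec* s q₀) p → observe r p ≡ observe (exec* s q) p
      through {p} a b e =
        trans (at (≈⇒∼ b) p) (trans e (sym (at (run-cong (step s) (≈⇒∼ a)) p)))

      go : ∀ p →
        (∀ {σ} → q ∼ ret σ → E s σ r → observe r p ≡ observe (exec s σ) p) →
        UniqueBelow* s p → EvalRule* E E* s q r → observe r p ≡ observe (exec* s q) p
      go p h below (ret* a x) = through {p} a ≈-refl (h (≈⇒∼ a) x)
      go []      h below (in* a b x)  = through {[]} a b refl
      go (v ∷ p) h below (in* a b x)  = through {v ∷ p} a b (below (x v))
      go []      h below (out* a b x) = through {[]} a b refl
      go (v ∷ p) h below (out* a b x) = through {v ∷ p} a b (below x)
      go []      h below (δ* a b x)   = through {[]} a b refl
      go (v ∷ p) h below (δ* a b x)   = through {v ∷ p} a b (below x)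

    unique* : ∀ s → (∀ p → UniqueAt s p) → ∀ p → UniqueAt* s p
    unique* s u = uniqueAt*-induction s λ p below → uniqueAt*-step s p (λ _ → u p) below

    δ≁ret : ∀ {r σ} → ¬ (δ r ∼ ret σ)
    δ≁ret e with () ← at e []

    uniqueAt-while : ∀ e sₜ → (∀ p → UniqueAt* sₜ p) → ∀ p →
      UniqueBelow* (while e loop sₜ) p → UniqueAt (while e loop sₜ) p
    uniqueAt-while e sₜ u p below {σ} x with eval x
    ... | while-false f b =
      at (∼-trans (≈⇒∼ b) (∼-sym (exec-while-false e sₜ σ f))) p
    ... | while-true {r = q} t y z =
      trans
        (uniqueAt*-step w p
          -- Here `ret*` would need the loop at the same path `p`; the `δ` before the body excludes
          -- it.
          (λ q∼ret → ⊥-elim (δ≁ret (∼-trans (∼-sym q∼δ) q∼ret)))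
          below z)
        (at (∼-trans (run-cong (step w) q∼) (∼-sym (exec-while-true e sₜ σ t))) p)
      where
      w = while e loop sₜ

      q∼ : q ∼ exec* sₜ (δ (ret σ))
      q∼ = pointwise λ p → u p y

      q∼δ : q ∼ δ (exec sₜ σ)
      q∼δ = ∼-trans q∼ (exec*-δ sₜ (ret σ))

    unique : ∀ s p → UniqueAt s p
    unique skip p {σ} x with eval x
    ... | skip b = at (∼-trans (≈⇒∼ b) (∼-sym (exec-skip σ))) p
    unique (s₀ ⨾ s₁) p {σ} x with eval x
    ... | seq {r = q} y z =
      trans (unique* s₁ (unique s₁) p z)
        (at (∼-trans (run-cong (step s₁) q∼) (∼-sym (exec-seq s₀ s₁ σ))) p)
      where
      q∼ : q ∼ exec s₀ σ
      -- All paths are needed, since `run-cong` replaces the whole intermediate resumption; the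
      -- recursion is on `s₀`.
      q∼ = pointwise λ p′ → unique s₀ p′ y
    unique (a := e) p {σ} x with eval x
    ... | assign b = at (∼-trans (≈⇒∼ b) (∼-sym (exec-assign a e σ))) p
    unique (if e then sₜ else s_f) p {σ} x with eval x
    ... | if-true t y =
      trans (unique* sₜ (unique sₜ) p y) (sym (at (exec-if-true e sₜ s_f σ t) p))
    ... | if-false f y =
      trans (unique* s_f (unique s_f) p y) (sym (at (exec-if-false e sₜ s_f σ f) p))
    unique (while e loop sₜ) = λ p → uniqueAt-while e sₜ body p (below p)
      where
      w = while e loop sₜ

      body : ∀ p → UniqueAt* sₜ p
      body = unique* sₜ (unique sₜ)

      -- Induction on the path is sound since `uniqueAt-while` consults the loop only at the tail of
      -- `p`.
      loop : ∀ p → UniqueAt* w p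
      loop = uniqueAt*-induction w λ p below → uniqueAt*-step w p
        (λ _ → uniqueAt-while e sₜ body p below) below

      below : ∀ p → UniqueBelow* w p
      below []      = _
      below (_ ∷ p) = loop p
    unique (input a) p {σ} x with eval x
    ... | input b = at (∼-trans (≈⇒∼ b) (∼-sym (exec-input a σ))) p
    unique (output e) p {σ} x with eval x
    ... | output b = at (∼-trans (≈⇒∼ b) (∼-sym (exec-output e σ))) p

  -- The three properties.

  ⇒-respects-≈ : ∀ s σ r r′ → ⟨ s , σ ⟩⇒ r → r ≈ r′ → ⟨ s , σ ⟩⇒ r′
  ⇒-respects-≈ s σ r r′ (_ , _ , isEval , x) e =
    _ , _ , Saturation.saturated isEval , (r , x , ≈-sym e)

  ⇒-total : ∀ s σ → ∃[ r ] ⟨ s , σ ⟩⇒ r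
  ⇒-total s σ = exec s σ , _ , _ , exec-IsEvaluation , ≈-refl

  ⇒-deterministic : ∀ s σ r r′ → ⟨ s , σ ⟩⇒ r → ⟨ s , σ ⟩⇒ r′ → r ≈ r′
  ⇒-deterministic s σ r r′ (_ , _ , i , x) (_ , _ , j , y) =
    -- The two derivations may use different relations `E` and `E*`; only `exec` is common to both.
    ∼⇒≈ (pointwise λ p → trans (Uniqueness.unique i s p x) (sym (Uniqueness.unique j s p y)))

lemma4p1 : (Var : Set) (_≟_ : DecidableEquality Var)
    (Expr : Set) (⟦_⟧_ : Expr → (Var → ℤ) → ℤ) →
    let open Semantics Var _≟_ Expr ⟦_⟧_ in
    (∀ s σ r r′ → ⟨ s , σ ⟩⇒ r → r ≈ r′ → ⟨ s , σ ⟩⇒ r′)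
    × (∀ s σ → ∃[ r ] ⟨ s , σ ⟩⇒ r)
    × (∀ s σ r r′ → ⟨ s , σ ⟩⇒ r → ⟨ s , σ ⟩⇒ r′ → r ≈ r′)
lemma4p1 Var _≟_ Expr ⟦_⟧_ =
  ⇒-respects-≈ Var _≟_ Expr ⟦_⟧_ ,
  ⇒-total Var _≟_ Expr ⟦_⟧_ ,
  ⇒-deterministic Var _≟_ Expr ⟦_⟧_
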